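{- For every positive integer $n\equiv 0\pmod{14}$ there is a $\left(\frac{13n}{14}-2\right)$-regular maximal $(2,3)$-antichain on $n$ points, and for every positive integer $n\equiv 0\pmod{16}$ there is a $\left(\frac{15n}{16}-2\right)$-regular maximal $(2,3)$-antichain on $n$ points.
   Context: Let $[n]=\{1,2,\ldots,n\}$. A maximal $(2,3)$-antichain on $n$ points is a family $\mathcal{A}=\mathcal{A}_2\cup\mathcal{A}_3$ with $\mathcal{A}_2\subseteq\binom{[n]}{2}$ (2-element subsets) and $\mathcal{A}_3\subseteq\binom{[n]}{3}$ (3-element subsets) such that (1) no member of $\mathcal{A}$ is a subset of another member of $\mathcal{A}$, and (2) for every $X\in 2^{[n]}\setminus\mathcal{A}$ there is an $A\in\mathcal{A}$ with $X\subseteq A$ or $A\subseteq X$. It is $r$-regular if every element of $[n]$ is contained in exactly $r$ members of $\mathcal{A}$. -}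

module Defs where

open import Data.Bool using (Bool; T)
open import Data.Fin using (Fin)
open import Data.Fin.Subset using (Subset; _∈_; _⊆_; _⊈_; ∣_∣)
open import Data.Nat using (ℕ)
open import Data.Product using (∃-syntax; _×_)
open import Data.Sum using (_⊎_)
open import Function.Bundles using (_↔_)
open import Relation.Binary.PropositionalEquality using (_≡_; _≢_)
open import Relation.Nullary using (¬_)

-- The ground set [n] is Fin n.  A family is a Boolean predicate, so that
-- membership is decidable and has at most one proof; the latter is what makes
-- the bijection in Regular count sets rather than membership proofs.
Family : ℕ → Set
Family n = Subset n → Bool

infix 4 _∈ᶠ_ _∉ᶠ_

_∈ᶠ_ : {n : ℕ} → Subset n → Family n → Set
A ∈ᶠ 𝒜 = T (𝒜 A)

_∉ᶠ_ : {n : ℕ} → Subset n → Family n → Set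
A ∉ᶠ 𝒜 = ¬ (A ∈ᶠ 𝒜)

record IsMaximal23Antichain {n : ℕ} (𝒜 : Family n) : Set where
  field
    sizes     : ∀ (A : Subset n) → A ∈ᶠ 𝒜 → ∣ A ∣ ≡ 2 ⊎ ∣ A ∣ ≡ 3
    antichain : ∀ (A B : Subset n) → A ∈ᶠ 𝒜 → B ∈ᶠ 𝒜 → A ≢ B → A ⊈ B
    maximal   : ∀ (X : Subset n) → X ∉ᶠ 𝒜 →
                ∃[ A ] (A ∈ᶠ 𝒜 × (X ⊆ A ⊎ A ⊆ X))

Regular : {n : ℕ} → ℕ → Family n → Set
Regular {n} r 𝒜 = ∀ (x : Fin n) → Fin r ↔ (∃[ A ] (A ∈ᶠ 𝒜 × x ∈ A))

{-# OPTIONS --safe #-}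
-- The 2-sets of the antichain are the non-edges of a graph and the 3-sets its
-- triangles; maximality says that every edge lies in a triangle.  A vertex of
-- degree d in t triangles lies in n - 1 - d + t members, so d - t must be k + 1,
-- where n = 2mk and m is 7 or 8.
--
-- The vertices are the triples (u, i, s) with u < k, i ∈ ℤ/m and s ∈ {0, 1}.
-- Those differing only in s are mates, and (u, i, s) is joined to every vertex of
-- group i + 1 + s.  For m ≥ 7 the digraph on ℤ/m with steps 1 and 2 has no
-- directed cycle of length at most 3, so the only triangles consist of a vertex
-- and two mates in one of the groups it points to.  Hence d = 2k + 2k + 1 and
-- t = k + 2k.
module Submission where

open import Defs
open import Data.Nat using (ℕ; _*_; _∸_; _<_)
open import Data.Nat.DivMod using (_/_)
open import Data.Nat.Divisibility using (_∣_)
open import Data.Product using (Σ; _×_)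

open import Data.Bool.Properties using (T-irrelevant) renaming (_≟_ to _≟ᵇ_)
open import Data.Fin using (Fin; zero; suc; toℕ; opposite)
open import Data.Fin.Properties using (_≟_; any?; all?; +↔⊎; *↔×; opposite-involutive)
open import Data.Fin.Permutation using (↔⇒≡)
open import Data.Fin.Subset using (Subset; _∈_; _∉_; _⊆_; ∣_∣; ⁅_⁆; _∪_; ∁; inside; outside)
open import Data.Fin.Subset.Properties
  using (_∈?_; nonempty?; x∈⁅x⁆; x∈⁅y⁆⇒x≡y; ∣⁅x⁆∣≡1; ⊆-antisym; p⊆q⇒∣p∣≤∣q∣; p⊂q⇒∣p∣<∣q∣;
         x∈∁p⇒x∉p; x∉p⇒x∈∁p; ∣∁p∣≡n∸∣p∣; x∈p∪q⁻; x∈p∪q⁺; ∪-comm; ∪-assoc; ∪-identityˡ)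
open import Data.Nat using (zero; suc; _+_; NonZero)
open import Data.Nat.DivMod using (_mod_; m*n/n≡m)
open import Data.Nat.Divisibility using (divides)
open import Data.Nat.Properties using (*-assoc; <-irrefl; 1+n≰n; m+n∸m≡n)
open import Data.Nat.Tactic.RingSolver using (solve-∀)
open import Data.Product using (∃-syntax; _,_; proj₁; proj₂)
open import Data.Product.Properties using () renaming (≡-dec to ≡-dec×)
open import Data.Product.Function.NonDependent.Propositional using (_×-↔_)
open import Data.Sum using (_⊎_; inj₁; inj₂; [_,_]′)
open import Data.Sum.Function.Propositional using (_⊎-↔_)
open import Data.Vec using ([]; _∷_; tabulate; here; there)
open import Data.Vec.Properties using (≡-dec; lookup∘tabulate; []=⇒lookup; lookup⇒[]=)
open import Data.Vec.Properties.WithK using ([]=-irrelevant)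
open import Function using (_∘_)
open import Function.Bundles using (_↔_; Inverse; mk↔ₛ′)
open import Function.Construct.Composition using (_↔-∘_)
open import Function.Construct.Identity using (↔-id)
open import Function.Construct.Symmetry using (↔-sym)
open import Function.Definitions using (Injective)
open import Relation.Binary.PropositionalEquality
  using (_≡_; _≢_; refl; sym; trans; cong; cong₂; subst; ≢-sym)
open import Relation.Nullary using (¬_; Dec; does; yes; no; contradiction)
open import Relation.Nullary.Decidable
  using (⌊_⌋; toWitness; fromWitness; map′; _×-dec_; _⊎-dec_; ¬?; from-yes; decidable-stable; dec-true)

-- Cardinalities of finite subsets and counting by bijections.

private
  variable
    n : ℕ
    p q : Subset n

⊆∧≡⇒≡ : p ⊆ q → ∣ p ∣ ≡ ∣ q ∣ → p ≡ q
⊆∧≡⇒≡ {p = p} p⊆q eq = ⊆-antisym p⊆q λ {x} x∈q →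
  decidable-stable (x ∈? p) λ x∉p → <-irrefl eq (p⊂q⇒∣p∣<∣q∣ (p⊆q , x , x∈q , x∉p))

∣⁅x⁆∪p∣≡1+∣p∣ : ∀ (x : Fin n) p → x ∉ p → ∣ ⁅ x ⁆ ∪ p ∣ ≡ suc ∣ p ∣
∣⁅x⁆∪p∣≡1+∣p∣ zero    (inside  ∷ p) x∉p = contradiction here x∉p
∣⁅x⁆∪p∣≡1+∣p∣ zero    (outside ∷ p) x∉p = cong (suc ∘ ∣_∣) (∪-identityˡ p)
∣⁅x⁆∪p∣≡1+∣p∣ (suc x) (inside  ∷ p) x∉p = cong suc (∣⁅x⁆∪p∣≡1+∣p∣ x p (x∉p ∘ there))
∣⁅x⁆∪p∣≡1+∣p∣ (suc x) (outside ∷ p) x∉p = ∣⁅x⁆∪p∣≡1+∣p∣ x p (x∉p ∘ there)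

-- Turns a cardinality into a bijection with `Fin`, the form in which `Regular` counts members.
Fin∣p∣↔∈p : ∀ (p : Subset n) → Fin ∣ p ∣ ↔ (∃[ x ] x ∈ p)
Fin∣p∣↔∈p []            = mk↔ₛ′ (λ ()) (λ ()) (λ ()) (λ ())
Fin∣p∣↔∈p (outside ∷ p) = mk↔ₛ′
  (λ k → let x , x∈p = to k in suc x , there x∈p)
  (λ { (suc x , there x∈p) → from (x , x∈p) })
  (λ { (suc x , there x∈p) → cong (λ (y , y∈p) → suc y , there y∈p) (strictlyInverseˡ (x , x∈p)) })
  strictlyInverseʳ
  where open Inverse (Fin∣p∣↔∈p p)
Fin∣p∣↔∈p (inside  ∷ p) = mk↔ₛ′
  (λ { zero → zero , here ; (suc k) → let x , x∈p = to k in suc x , there x∈p })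
  (λ { (zero , here) → zero ; (suc x , there x∈p) → suc (from (x , x∈p)) })
  (λ { (zero , here) → refl
     ; (suc x , there x∈p) → cong (λ (y , y∈p) → suc y , there y∈p) (strictlyInverseˡ (x , x∈p)) })
  (λ { zero → refl ; (suc k) → cong suc (strictlyInverseʳ k) })
  where open Inverse (Fin∣p∣↔∈p p)

injective∧surjective⇒↔ : {A B : Set} (f : A → B) → Injective _≡_ _≡_ f → (∀ b → ∃[ a ] f a ≡ b) → A ↔ B
injective∧surjective⇒↔ f inj surj =
  mk↔ₛ′ f (proj₁ ∘ surj) (proj₂ ∘ surj) (λ a → inj (proj₂ (surj (f a))))

comprehension : {P : Fin n → Set} → (∀ x → Dec (P x)) → Subset n
comprehension P? = tabulate (does ∘ P?)

module _ {P : Fin n → Set} (P? : ∀ x → Dec (P x)) where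

  ∈-comprehension⁺ : ∀ {x} → P x → x ∈ comprehension P?
  ∈-comprehension⁺ {x} px = lookup⇒[]= x _ (trans (lookup∘tabulate _ x) (dec-true (P? x) px))

  ∈-comprehension⁻ : ∀ {x} → x ∈ comprehension P? → P x
  ∈-comprehension⁻ {x} x∈p with P? x | trans (sym (lookup∘tabulate (does ∘ P?) x)) ([]=⇒lookup x∈p)
  ... | yes px | _ = px

-- Sets of two and three points.

pair : Fin n → Fin n → Subset n
pair x y = ⁅ x ⁆ ∪ ⁅ y ⁆

triple : Fin n → Fin n → Fin n → Subset n
triple x y z = ⁅ x ⁆ ∪ pair y z

module _ {x y : Fin n} where

  ∈-pair⁻ : ∀ {a} → a ∈ pair x y → a ≡ x ⊎ a ≡ y
  ∈-pair⁻ a∈ with x∈p∪q⁻ ⁅ x ⁆ ⁅ y ⁆ a∈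
  ... | inj₁ a∈x = inj₁ (x∈⁅y⁆⇒x≡y x a∈x)
  ... | inj₂ a∈y = inj₂ (x∈⁅y⁆⇒x≡y y a∈y)

  pairˡ : x ∈ pair x y
  pairˡ = x∈p∪q⁺ (inj₁ (x∈⁅x⁆ x))

  pairʳ : y ∈ pair x y
  pairʳ = x∈p∪q⁺ (inj₂ (x∈⁅x⁆ y))

  pair⊆ : x ∈ p → y ∈ p → pair x y ⊆ p
  pair⊆ x∈p y∈p a∈ with ∈-pair⁻ a∈
  ... | inj₁ refl = x∈p
  ... | inj₂ refl = y∈p

  ∣pair∣≡2 : x ≢ y → ∣ pair x y ∣ ≡ 2
  ∣pair∣≡2 x≢y = trans (∣⁅x⁆∪p∣≡1+∣p∣ x ⁅ y ⁆ (x≢y ∘ x∈⁅y⁆⇒x≡y y)) (cong suc (∣⁅x⁆∣≡1 y))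

module _ {x y z : Fin n} where

  ∈-triple⁻ : ∀ {a} → a ∈ triple x y z → a ≡ x ⊎ a ≡ y ⊎ a ≡ z
  ∈-triple⁻ a∈ with x∈p∪q⁻ ⁅ x ⁆ (pair y z) a∈
  ... | inj₁ a∈x  = inj₁ (x∈⁅y⁆⇒x≡y x a∈x)
  ... | inj₂ a∈yz = inj₂ (∈-pair⁻ a∈yz)

  triple₁ : x ∈ triple x y z
  triple₁ = x∈p∪q⁺ (inj₁ (x∈⁅x⁆ x))

  triple₂ : y ∈ triple x y z
  triple₂ = x∈p∪q⁺ {p = ⁅ x ⁆} (inj₂ pairˡ)

  triple₃ : z ∈ triple x y z
  triple₃ = x∈p∪q⁺ {p = ⁅ x ⁆} (inj₂ (pairʳ {x = y}))

  triple⊆ : x ∈ p → y ∈ p → z ∈ p → triple x y z ⊆ p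
  triple⊆ x∈p y∈p z∈p a∈ with ∈-triple⁻ a∈
  ... | inj₁ refl        = x∈p
  ... | inj₂ (inj₁ refl) = y∈p
  ... | inj₂ (inj₂ refl) = z∈p

  ∣triple∣≡3 : x ≢ y → x ≢ z → y ≢ z → ∣ triple x y z ∣ ≡ 3
  ∣triple∣≡3 x≢y x≢z y≢z =
    trans (∣⁅x⁆∪p∣≡1+∣p∣ x (pair y z) ([ x≢y , x≢z ]′ ∘ ∈-pair⁻)) (cong suc (∣pair∣≡2 y≢z))

  triple-swap₂₃ : triple x y z ≡ triple x z y
  triple-swap₂₃ = cong (⁅ x ⁆ ∪_) (∪-comm ⁅ y ⁆ ⁅ z ⁆)

  triple-swap₁₂ : triple x y z ≡ triple y x z
  triple-swap₁₂ = trans (sym (∪-assoc ⁅ x ⁆ ⁅ y ⁆ ⁅ z ⁆))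
    (trans (cong (_∪ ⁅ z ⁆) (∪-comm ⁅ x ⁆ ⁅ y ⁆)) (∪-assoc ⁅ y ⁆ ⁅ x ⁆ ⁅ z ⁆))

-- The antichain of non-edges and triangles of a graph.

record Graph (n : ℕ) : Set₁ where
  infix 4 _~_ _~?_
  field
    _~_       : Fin n → Fin n → Set
    _~?_      : ∀ x y → Dec (x ~ y)
    ~-sym     : ∀ {x y} → x ~ y → y ~ x
    ~⇒≢       : ∀ {x y} → x ~ y → x ≢ y
    -- Together with `apex` this puts every vertex in a triangle, which settles maximality for the
    -- empty set and the singletons.
    neighbour : ∀ x → ∃[ y ] x ~ y
    apex      : ∀ {x y} → x ~ y → ∃[ z ] (x ~ z × y ~ z)

  data Member (A : Subset n) : Set where
    nonedge  : ∀ x y → x ≢ y → ¬ x ~ y → A ≡ pair x y → Member A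
    triangle : ∀ x y z → x ~ y → x ~ z → y ~ z → A ≡ triple x y z → Member A

  member? : ∀ A → Dec (Member A)
  member? A = map′
    [ (λ (x , y , x≢y , x≁y , eq) → nonedge x y x≢y x≁y eq)
    , (λ (x , y , z , xy , xz , yz , eq) → triangle x y z xy xz yz eq) ]′
    (λ { (nonedge x y x≢y x≁y eq) → inj₁ (x , y , x≢y , x≁y , eq)
       ; (triangle x y z xy xz yz eq) → inj₂ (x , y , z , xy , xz , yz , eq) })
    (any? (λ x → any? λ y → ¬? (x ≟ y) ×-dec ¬? (x ~? y) ×-dec A ≟ˢ pair x y)
     ⊎-dec
     any? (λ x → any? λ y → any? λ z →
       (x ~? y) ×-dec (x ~? z) ×-dec (y ~? z) ×-dec A ≟ˢ triple x y z))
    where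
    infix 4 _≟ˢ_
    _≟ˢ_ : ∀ (B C : Subset n) → Dec (B ≡ C)
    _≟ˢ_ = ≡-dec _≟ᵇ_

  -- One set has several `Member` proofs, one for each ordering of its points. The Boolean forgets
  -- them, so that each set counts once.
  family : Family n
  family A = ⌊ member? A ⌋

  ∈⇒member : ∀ {A} → A ∈ᶠ family → Member A
  ∈⇒member {A} = toWitness {a? = member? A}

  member⇒∈ : ∀ {A} → Member A → A ∈ᶠ family
  member⇒∈ {A} = fromWitness {a? = member? A}

  pair∈ : ∀ {x y} → x ≢ y → ¬ x ~ y → pair x y ∈ᶠ family
  pair∈ x≢y x≁y = member⇒∈ (nonedge _ _ x≢y x≁y refl)

  triple∈ : ∀ {x y z} → x ~ y → x ~ z → y ~ z → triple x y z ∈ᶠ family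
  triple∈ xy xz yz = member⇒∈ (triangle _ _ _ xy xz yz refl)

  ∣triangle∣≡3 : ∀ {x y z} → x ~ y → x ~ z → y ~ z → ∣ triple x y z ∣ ≡ 3
  ∣triangle∣≡3 xy xz yz = ∣triple∣≡3 (~⇒≢ xy) (~⇒≢ xz) (~⇒≢ yz)

  triangle-clique : ∀ {x y z a b} → x ~ y → x ~ z → y ~ z →
                    a ∈ triple x y z → b ∈ triple x y z → a ≢ b → a ~ b
  triangle-clique {x} {y} {z} xy xz yz a∈ b∈ a≢b
    with ∈-triple⁻ {x = x} {y} {z} a∈ | ∈-triple⁻ {x = x} {y} {z} b∈
  ... | inj₁ refl        | inj₁ refl        = contradiction refl a≢b
  ... | inj₁ refl        | inj₂ (inj₁ refl) = xy
  ... | inj₁ refl        | inj₂ (inj₂ refl) = xz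
  ... | inj₂ (inj₁ refl) | inj₁ refl        = ~-sym xy
  ... | inj₂ (inj₁ refl) | inj₂ (inj₁ refl) = contradiction refl a≢b
  ... | inj₂ (inj₁ refl) | inj₂ (inj₂ refl) = yz
  ... | inj₂ (inj₂ refl) | inj₁ refl        = ~-sym xz
  ... | inj₂ (inj₂ refl) | inj₂ (inj₁ refl) = ~-sym yz
  ... | inj₂ (inj₂ refl) | inj₂ (inj₂ refl) = contradiction refl a≢b

  member-size : ∀ {A} → Member A → ∣ A ∣ ≡ 2 ⊎ ∣ A ∣ ≡ 3
  member-size (nonedge x y x≢y x≁y refl)      = inj₁ (∣pair∣≡2 x≢y)
  member-size (triangle x y z xy xz yz refl) = inj₂ (∣triangle∣≡3 xy xz yz)

  -- A non-edge inside a triangle would be an edge. In the other cases sizes decide: an inclusion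
  -- between sets of equal size is an equality, and three points do not fit into two.
  members-incomparable : ∀ {A B} → Member A → Member B → A ⊆ B → A ≡ B
  members-incomparable (nonedge _ _ a≢b a≁b refl) (nonedge _ _ x≢y x≁y refl) A⊆B =
    ⊆∧≡⇒≡ A⊆B (trans (∣pair∣≡2 a≢b) (sym (∣pair∣≡2 x≢y)))
  members-incomparable (nonedge a b a≢b a≁b refl) (triangle _ _ _ xy xz yz refl) A⊆B =
    contradiction (triangle-clique xy xz yz (A⊆B pairˡ) (A⊆B (pairʳ {x = a})) a≢b) a≁b
  members-incomparable (triangle _ _ _ ab ac bc refl) (nonedge _ _ x≢y x≁y refl) A⊆B
    with p⊆q⇒∣p∣≤∣q∣ A⊆B
  ... | 3≤2 rewrite ∣triangle∣≡3 ab ac bc | ∣pair∣≡2 x≢y = contradiction 3≤2 1+n≰n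
  members-incomparable (triangle _ _ _ ab ac bc refl) (triangle _ _ _ xy xz yz refl) A⊆B =
    ⊆∧≡⇒≡ A⊆B (trans (∣triangle∣≡3 ab ac bc) (sym (∣triangle∣≡3 xy xz yz)))

  triangle-through : ∀ x → ∃[ y ] ∃[ z ] (x ~ y × x ~ z × y ~ z)
  triangle-through x =
    let y , xy = neighbour x ; z , xz , yz = apex xy in y , z , xy , xz , yz

  Comparable : Subset n → Set
  Comparable X = ∃[ A ] (A ∈ᶠ family × (X ⊆ A ⊎ A ⊆ X))

  -- Either `X` lies in the triangle that `apex` provides, or it has a point `w` outside. Then `w`
  -- forms a non-edge with `x` or `y`, or a triangle with both, and this member lies inside `X`.
  comparable-edge : ∀ {X x y} → x ∈ X → y ∈ X → x ~ y → Comparable X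
  comparable-edge {X} {x} {y} x∈X y∈X xy with apex xy
  ... | z , xz , yz with any? (λ w → (w ∈? X) ×-dec ¬? (w ∈? triple x y z))
  ...   | no ∄w = triple x y z , triple∈ xy xz yz ,
                  inj₁ λ {w} w∈X → decidable-stable (w ∈? triple x y z) λ w∉ → ∄w (w , w∈X , w∉)
  ...   | yes (w , w∈X , w∉) with x ~? w | y ~? w
  ...     | no x≁w | _ = pair x w , pair∈ (λ { refl → w∉ triple₁ }) x≁w , inj₂ (pair⊆ x∈X w∈X)
  ...     | yes _  | no y≁w =
    pair y w , pair∈ (λ { refl → w∉ (triple₂ {x = x}) }) y≁w , inj₂ (pair⊆ y∈X w∈X)
  ...     | yes xw | yes yw = triple x y w , triple∈ xy xw yw , inj₂ (triple⊆ x∈X y∈X w∈X)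

  -- A singleton lies in a triangle. Otherwise a second point of `X` forms with `x` either a
  -- non-edge, itself a member, or an edge, handled above.
  comparable-nonempty : ∀ {X x} → x ∈ X → Comparable X
  comparable-nonempty {X} {x} x∈X with any? (λ y → (y ∈? X) ×-dec ¬? (y ≟ x))
  ... | no ∄y =
    let y , z , xy , xz , yz = triangle-through x
    in triple x y z , triple∈ xy xz yz , inj₁ λ {w} w∈X →
         subst (_∈ triple x y z)
               (sym (decidable-stable (w ≟ x) λ w≢x → ∄y (w , w∈X , w≢x))) triple₁
  ... | yes (y , y∈X , y≢x) with x ~? y
  ...   | yes xy = comparable-edge x∈X y∈X xy
  ...   | no x≁y = pair x y , pair∈ (≢-sym y≢x) x≁y , inj₂ (pair⊆ x∈X y∈X)

  -- The empty set must lie below some member; the given point supplies a triangle for it.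
  isMaximal23Antichain : Fin n → IsMaximal23Antichain family
  isMaximal23Antichain x = record
    { sizes     = λ _ A∈ → member-size (∈⇒member A∈)
    ; antichain = λ _ _ A∈ B∈ A≢B A⊆B → A≢B (members-incomparable (∈⇒member A∈) (∈⇒member B∈) A⊆B)
    ; maximal   = λ X _ → comparable X
    }
    where
    comparable : ∀ X → Comparable X
    comparable X with nonempty? X
    ... | yes (_ , x∈X) = comparable-nonempty x∈X
    ... | no  X-empty =
      let y , z , xy , xz , yz = triangle-through x
      in triple x y z , triple∈ xy xz yz , inj₁ λ w∈X → contradiction (_ , w∈X) X-empty

-- Counting the members through a vertex.

-- K enumerates the closed neighbourhood of x, L the edges inside the open one.
-- The conditions on sinks ensure that distinct links are distinct unordered edges.
record Surroundings (G : Graph n) (x : Fin n) (c t : ℕ) : Set₁ where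
  open Graph G
  field
    K             : Set
    K-size        : Fin c ↔ K
    near          : K → Fin n
    near-injective : Injective _≡_ _≡_ near
    near-sound    : ∀ k → x ≡ near k ⊎ x ~ near k
    near-complete : ∀ {y} → x ≡ y ⊎ x ~ y → ∃[ k ] near k ≡ y
    L             : Set
    L-size        : Fin t ↔ L
    source sink   : L → Fin n
    x~source      : ∀ l → x ~ source l
    x~sink        : ∀ l → x ~ sink l
    source~sink   : ∀ l → source l ~ sink l
    sink-injective : Injective _≡_ _≡_ sink
    sink≢source   : ∀ l l′ → sink l ≢ source l′
    L-complete    : ∀ {y z} → x ~ y → x ~ z → y ~ z →
                    ∃[ l ] ((source l ≡ y × sink l ≡ z) ⊎ (source l ≡ z × sink l ≡ y))

  near? : ∀ y → Dec (x ≡ y ⊎ x ~ y)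
  near? y = (x ≟ y) ⊎-dec (x ~? y)

  far : Subset n
  far = ∁ (comprehension near?)

  ∈-far⁺ : ∀ {y} → x ≢ y → ¬ x ~ y → y ∈ far
  ∈-far⁺ x≢y x≁y = x∉p⇒x∈∁p ([ x≢y , x≁y ]′ ∘ ∈-comprehension⁻ near?)

  ∈-far⁻ : ∀ {y} → y ∈ far → ¬ (x ≡ y ⊎ x ~ y)
  ∈-far⁻ y∈far = x∈∁p⇒x∉p y∈far ∘ ∈-comprehension⁺ near?

  K↔near : K ↔ (∃[ y ] y ∈ comprehension near?)
  K↔near = injective∧surjective⇒↔
    (λ k → near k , ∈-comprehension⁺ near? (near-sound k))
    (near-injective ∘ cong proj₁)
    (λ (y , y∈) → let k , eq = near-complete (∈-comprehension⁻ near? y∈) in k , ∈-≡ eq)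
    where
    ∈-≡ : {a b : ∃[ y ] y ∈ comprehension near?} → proj₁ a ≡ proj₁ b → a ≡ b
    ∈-≡ {y , y∈} {_ , y∈′} refl = cong (y ,_) ([]=-irrelevant y∈ y∈′)

  ∣far∣≡n∸c : ∣ far ∣ ≡ n ∸ c
  ∣far∣≡n∸c = trans (∣∁p∣≡n∸∣p∣ (comprehension near?))
    (cong (n ∸_) (↔⇒≡ (↔-sym K-size ↔-∘ (↔-sym K↔near ↔-∘ Fin∣p∣↔∈p (comprehension near?)))))

  Through : Set
  Through = ∃[ A ] (A ∈ᶠ family × x ∈ A)

  -- Both membership proofs are unique, so bijections with `Through` count sets.
  through-≡ : {a b : Through} → proj₁ a ≡ proj₁ b → a ≡ b
  through-≡ {A , A∈ , x∈} {_ , A∈′ , x∈′} refl =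
    cong₂ (λ u v → A , u , v) (T-irrelevant A∈ A∈′) ([]=-irrelevant x∈ x∈′)

  through : (∃[ y ] y ∈ far) ⊎ L → Through
  through (inj₁ (y , y∈far)) =
    pair x y , pair∈ (∈-far⁻ y∈far ∘ inj₁) (∈-far⁻ y∈far ∘ inj₂) , pairˡ
  through (inj₂ l) =
    triple x (source l) (sink l) , triple∈ (x~source l) (x~sink l) (source~sink l) , triple₁

  pair≢triple : ∀ {y} → y ∈ far → ∀ l → pair x y ≢ triple x (source l) (sink l)
  pair≢triple y∈far l eq =
    contradiction (trans (sym (∣pair∣≡2 (∈-far⁻ y∈far ∘ inj₁)))
                  (trans (cong ∣_∣ eq) (∣triangle∣≡3 (x~source l) (x~sink l) (source~sink l))))
                  λ ()

  -- A pair determines its point other than `x`. A triangle determines its link because its sink is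
  -- neither `x` nor the source of any link, so it can only equal the other sink.
  through-injective : Injective _≡_ _≡_ through
  through-injective {inj₁ (y , y∈far)} {inj₁ (y′ , y′∈far)} eq
    with ∈-pair⁻ {x = x} (subst (y ∈_) (cong proj₁ eq) (pairʳ {x = x}))
  ... | inj₁ refl = contradiction (inj₁ refl) (∈-far⁻ y∈far)
  ... | inj₂ refl = cong (λ m → inj₁ (y , m)) ([]=-irrelevant y∈far y′∈far)
  through-injective {inj₁ (y , y∈far)} {inj₂ l} eq = contradiction (cong proj₁ eq) (pair≢triple y∈far l)
  through-injective {inj₂ l} {inj₁ (y , y∈far)} eq =
    contradiction (sym (cong proj₁ eq)) (pair≢triple y∈far l)
  through-injective {inj₂ l} {inj₂ l′} eq
    with ∈-triple⁻ {x = x} {source l′}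
           (subst (sink l ∈_) (cong proj₁ eq) (triple₃ {x = x} {source l}))
  ... | inj₁ sink≡x           = contradiction (sym sink≡x) (~⇒≢ (x~sink l))
  ... | inj₂ (inj₁ sink≡src)  = contradiction sink≡src (sink≢source l l′)
  ... | inj₂ (inj₂ sink≡sink) = cong inj₂ (sink-injective sink≡sink)

  -- A member lists its points in any order, so `x` is first moved to the front; what remains is a
  -- far point or an edge among the neighbours of `x`.
  through-surjective : ∀ a → ∃[ u ] through u ≡ a
  through-surjective (A , A∈ , x∈A) =
    let u , eq = preimage (∈⇒member A∈) x∈A in u , through-≡ eq
    where
    Preimage : Subset n → Set
    Preimage A = ∃[ u ] proj₁ (through u) ≡ A

    far-preimage : ∀ {y} → x ≢ y → ¬ x ~ y → Preimage (pair x y)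
    far-preimage x≢y x≁y = inj₁ (_ , ∈-far⁺ x≢y x≁y) , refl

    triangle-preimage : ∀ {y z} → x ~ y → x ~ z → y ~ z → Preimage (triple x y z)
    triangle-preimage xy xz yz with L-complete xy xz yz
    ... | l , inj₁ (refl , refl) = inj₂ l , refl
    -- The link runs along the edge in the opposite direction.
    ... | l , inj₂ (refl , refl) = inj₂ l , triple-swap₂₃ {x = x}

    preimage : ∀ {A} → Member A → x ∈ A → Preimage A
    preimage (nonedge a b a≢b a≁b refl) x∈ with ∈-pair⁻ x∈
    ... | inj₁ refl = far-preimage a≢b a≁b
    ... | inj₂ refl = subst Preimage (∪-comm ⁅ x ⁆ ⁅ a ⁆) (far-preimage (≢-sym a≢b) (a≁b ∘ ~-sym))
    preimage (triangle a b c ab ac bc refl) x∈ with ∈-triple⁻ {x = a} x∈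
    ... | inj₁ refl        = triangle-preimage ab ac bc
    ... | inj₂ (inj₁ refl) = subst Preimage (triple-swap₁₂ {x = x}) (triangle-preimage (~-sym ab) bc ac)
    ... | inj₂ (inj₂ refl) = subst Preimage
      (trans (triple-swap₁₂ {x = x}) (triple-swap₂₃ {x = a})) (triangle-preimage (~-sym ac) (~-sym bc) ab)

  count-through : Fin ((n ∸ c) + t) ↔ Through
  count-through = injective∧surjective⇒↔ through through-injective through-surjective
    ↔-∘ ((farFin ⊎-↔ L-size) ↔-∘ +↔⊎)
    where
    farFin : Fin (n ∸ c) ↔ (∃[ y ] y ∈ far)
    farFin = subst (λ m → Fin m ↔ (∃[ y ] y ∈ far)) ∣far∣≡n∸c (Fin∣p∣↔∈p far)

-- Digraphs of out-degree two without short directed cycles.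

record Orientation (m : ℕ) : Set where
  field
    -- Two permutations of the groups with their inverses. In the blow-up the label of a vertex
    -- selects the permutation that it follows.
    step back  : Fin 2 → Fin m → Fin m
    step-back  : ∀ s i → step s (back s i) ≡ i
    back-step  : ∀ s i → back s (step s i) ≡ i
    step-fork  : ∀ i → step zero i ≢ step (suc zero) i
    no-loop    : ∀ s i → step s i ≢ i
    no-2-cycle : ∀ s t i → step t (step s i) ≢ i
    no-3-cycle : ∀ s t r i → step r (step t (step s i)) ≢ i

  step-label : ∀ s t i → step s i ≡ step t i → s ≡ t
  step-label zero       zero       i eq = refl
  step-label zero       (suc zero) i eq = contradiction eq (step-fork i)
  step-label (suc zero) zero       i eq = contradiction (sym eq) (step-fork i)
  step-label (suc zero) (suc zero) i eq = refl

  back≢ : ∀ s i → back s i ≢ i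
  back≢ s i eq = no-loop s i (trans (cong (step s) (sym eq)) (step-back s i))

  -- Since `step t` leads from `back t i` to `i`, a common value would close a directed 2-cycle.
  step≢back : ∀ s t i → step s i ≢ back t i
  step≢back s t i eq = no-2-cycle s t i (trans (cong (step t) eq) (step-back t i))

module Circulant (m : ℕ) .{{_ : NonZero m}} where

  step back : Fin 2 → Fin m → Fin m
  step s i = (toℕ i + suc (toℕ s)) mod m
  -- Adding the complement of the step length is subtraction modulo `m`; as steps are at most 2, the
  -- truncated difference is exact for `m` at least 2.
  back s i = (toℕ i + (m ∸ suc (toℕ s))) mod m

  Valid : Set
  Valid = (∀ s i → step s (back s i) ≡ i)
        × (∀ s i → back s (step s i) ≡ i)
        × (∀ i → step zero i ≢ step (suc zero) i)
        × (∀ s i → step s i ≢ i)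
        × (∀ s t i → step t (step s i) ≢ i)
        × (∀ s t r i → step r (step t (step s i)) ≢ i)

  valid? : Dec Valid
  valid? = (all? λ s → all? λ i → step s (back s i) ≟ i)
     ×-dec (all? λ s → all? λ i → back s (step s i) ≟ i)
     ×-dec (all? λ i → ¬? (step zero i ≟ step (suc zero) i))
     ×-dec (all? λ s → all? λ i → ¬? (step s i ≟ i))
     ×-dec (all? λ s → all? λ t → all? λ i → ¬? (step t (step s i) ≟ i))
     ×-dec (all? λ s → all? λ t → all? λ r → all? λ i → ¬? (step r (step t (step s i)) ≟ i))

  orientation : Valid → Orientation m
  orientation (sb , bs , fork , loop , cycle₂ , cycle₃) = record
    { step       = step
    ; back       = back
    ; step-back  = sb
    ; back-step  = bs
    ; step-fork  = fork
    ; no-loop    = loop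
    ; no-2-cycle = cycle₂
    ; no-3-cycle = cycle₃
    }

-- The conditions quantify over finite types and are decided by evaluation. They hold because one to
-- three steps add up to a number from 1 to 6, which is nonzero modulo 7 and modulo 8.
circulant₇ : Orientation 7
circulant₇ = Circulant.orientation 7 (from-yes (Circulant.valid? 7))

circulant₈ : Orientation 8
circulant₈ = Circulant.orientation 8 (from-yes (Circulant.valid? 8))

-- The blow-up graph.

opposite≢ : (s : Fin 2) → opposite s ≢ s
opposite≢ zero       ()
opposite≢ (suc zero) ()

≡⊎opposite : (s t : Fin 2) → s ≡ t ⊎ t ≡ opposite s
≡⊎opposite zero       zero       = inj₁ refl
≡⊎opposite zero       (suc zero) = inj₂ refl
≡⊎opposite (suc zero) zero       = inj₂ refl
≡⊎opposite (suc zero) (suc zero) = inj₁ refl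

module BlowUp {m : ℕ} (O : Orientation m) (k : ℕ) where
  open Orientation O

  Vertex : Set
  Vertex = Fin k × Fin m × Fin 2

  vertices : Fin (k * (m * 2)) ↔ Vertex
  vertices = (↔-id _ ×-↔ *↔×) ↔-∘ *↔×

  open Inverse vertices using (to; from; strictlyInverseˡ; strictlyInverseʳ)

  group : Vertex → Fin m
  group (_ , i , _) = i

  label : Vertex → Fin 2
  label (_ , _ , s) = s

  mate : Vertex → Vertex
  mate (u , i , s) = u , i , opposite s

  infix 4 _↝_
  -- Only the group of `b` enters, so `a` points to all 2k vertices of a single group.
  _↝_ : Vertex → Vertex → Set
  a ↝ b = step (label a) (group a) ≡ group b

  data Adjacent (a b : Vertex) : Set where
    mates : b ≡ mate a → Adjacent a b
    out   : a ↝ b → Adjacent a b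
    into  : b ↝ a → Adjacent a b

  mate-involutive : ∀ a → mate (mate a) ≡ a
  mate-involutive (u , i , s) = cong (λ t → u , i , t) (opposite-involutive s)

  mate≢ : ∀ a → mate a ≢ a
  mate≢ a eq = opposite≢ (label a) (cong label eq)

  ↝⇒group≢ : ∀ {a b} → a ↝ b → group a ≢ group b
  ↝⇒group≢ {a} ab eq = no-loop (label a) (group a) (trans ab (sym eq))

  ↝↝⇒group≢ : ∀ {a b c} → a ↝ b → b ↝ c → group a ≢ group c
  ↝↝⇒group≢ {a} {b} refl bc eq = no-2-cycle (label a) (label b) (group a) (trans bc (sym eq))

  ↝↝↝⇒group≢ : ∀ {a b c d} → a ↝ b → b ↝ c → c ↝ d → group a ≢ group d
  ↝↝↝⇒group≢ {a} {b} {c} refl refl cd eq =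
    no-3-cycle (label a) (label b) (label c) (group a) (trans cd (sym eq))

  -- Mates share a group but carry different labels, so by `step-fork` they point to different
  -- groups.
  mates-↝ : ∀ {a b} → a ↝ b → ¬ mate a ↝ b
  mates-↝ {a} ab mb = opposite≢ (label a) (step-label _ _ (group a) (trans mb (sym ab)))

  adjacent-sym : ∀ {a b} → Adjacent a b → Adjacent b a
  adjacent-sym {a} (mates refl) = mates (sym (mate-involutive a))
  adjacent-sym (out ab)         = into ab
  adjacent-sym (into ba)        = out ba

  adjacent⇒≢ : ∀ {a b} → Adjacent a b → a ≢ b
  adjacent⇒≢ {a} (mates eq) refl = mate≢ a (sym eq)
  adjacent⇒≢ {a} (out ab) refl   = ↝⇒group≢ {a} {a} ab refl
  adjacent⇒≢ {a} (into ba) refl  = ↝⇒group≢ {a} {a} ba refl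

  adjacent? : ∀ a b → Dec (Adjacent a b)
  adjacent? a b = map′
    [ mates , [ out , into ]′ ]′
    (λ { (mates eq) → inj₁ eq ; (out ab) → inj₂ (inj₁ ab) ; (into ba) → inj₂ (inj₂ ba) })
    (≡-decᵛ b (mate a) ⊎-dec (step (label a) (group a) ≟ group b)
     ⊎-dec (step (label b) (group b) ≟ group a))
    where
    ≡-decᵛ : (a b : Vertex) → Dec (a ≡ b)
    ≡-decᵛ = ≡-dec× _≟_ (≡-dec× _≟_ _≟_)

  -- A vertex with label `s` pointing to `a` has its group forced by `back`; the label and the index
  -- stay free, which gives 2k predecessors.
  predecessor : Fin 2 → Fin k → Vertex → Vertex
  predecessor s v a = v , back s (group a) , s

  predecessor-↝ : ∀ s v a → predecessor s v a ↝ a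
  predecessor-↝ s v a = step-back s (group a)

  -- Arcs enter whole groups: a predecessor of a vertex also points to its mate, and the tail of an
  -- arc is joined to the mate of the head.
  common-neighbour : ∀ {a b} → Adjacent a b → ∃[ c ] (Adjacent a c × Adjacent b c)
  common-neighbour {a} (mates refl) =
    let ↝a = predecessor-↝ zero (proj₁ a) a in predecessor zero (proj₁ a) a , into ↝a , into ↝a
  common-neighbour {a} {b} (out ab)  = mate b , out ab , mates refl
  common-neighbour {a} {b} (into ba) = mate a , mates refl , out ba

  -- Triangles of the blow-up.

  data Triangle (a b c : Vertex) : Set where
    apex    : a ↝ b → c ≡ mate b → Triangle a b c
    base    : b ≡ mate a → c ↝ a → Triangle a b c
    base′   : c ≡ mate a → b ↝ a → Triangle a b c

  -- Three arcs form a directed 3-cycle or a transitive triangle; in the latter the source points to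
  -- two vertices, hence of one group, yet an arc joins them. For mates and a third vertex, both
  -- cannot point to it, and one arc each way would give a 2-cycle of groups, so it points to both.
  classify : ∀ {a b c} → Adjacent a b → Adjacent a c → Adjacent b c → Triangle a b c
  classify (mates refl) (mates refl) bc = contradiction refl (adjacent⇒≢ bc)
  classify {a} (mates refl) (out ac) (mates refl) = contradiction refl (↝⇒group≢ {a} {a} ac)
  classify {a} {c = c} (mates refl) (out ac) (out bc) = contradiction bc (mates-↝ {a} {c} ac)
  classify {a} {c = c} (mates refl) (out ac) (into cb) = contradiction refl (↝↝⇒group≢ {a} {c} {a} ac cb)
  classify (mates eq) (into ca) bc = base eq ca
  classify {a} {b} (out ab) (mates refl) (mates eq) = contradiction (cong group eq) (↝⇒group≢ {a} {b} ab)
  classify {a} {b} (out ab) (mates refl) (out bc) = contradiction refl (↝↝⇒group≢ {a} {b} {a} ab bc)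
  classify {a} {b} (out ab) (mates refl) (into cb) = contradiction cb (mates-↝ {a} {b} ab)
  classify (into ba) (mates eq) bc = base′ eq ba
  classify (out ab) (out ac) (mates eq) = apex ab eq
  classify {a} {b} {c} (out ab) (out ac) (out bc) = contradiction (trans (sym ab) ac) (↝⇒group≢ {b} {c} bc)
  classify {a} {b} {c} (out ab) (out ac) (into cb) = contradiction (trans (sym ac) ab) (↝⇒group≢ {c} {b} cb)
  classify {a} {b} (out ab) (into ca) (mates refl) = contradiction refl (↝↝⇒group≢ {mate b} {a} {b} ca ab)
  classify {a} {b} {c} (out ab) (into ca) (out bc) = contradiction refl (↝↝↝⇒group≢ {a} {b} {c} {a} ab bc ca)
  classify {a} {b} {c} (out ab) (into ca) (into cb) =
    contradiction (trans (sym ca) cb) (↝⇒group≢ {a} {b} ab)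
  classify {a} {b} {c} (into ba) (out ac) (mates refl) = contradiction refl (↝↝⇒group≢ {b} {a} {c} ba ac)
  classify {a} {b} {c} (into ba) (out ac) (out bc) = contradiction (trans (sym ba) bc) (↝⇒group≢ {a} {c} ac)
  classify {a} {b} {c} (into ba) (out ac) (into cb) = contradiction refl (↝↝↝⇒group≢ {a} {c} {b} {a} ac cb ba)
  classify {a} {b} {c} (into ba) (into ca) (mates refl) = contradiction ca (mates-↝ {b} {a} ba)
  classify {a} {b} {c} (into ba) (into ca) (out bc) = contradiction (trans (sym bc) ba) (↝⇒group≢ {c} {a} ca)
  classify {a} {b} {c} (into ba) (into ca) (into cb) = contradiction (trans (sym cb) ca) (↝⇒group≢ {b} {a} ba)

  -- Enumeration of closed neighbourhoods and of the edges inside open ones.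

  predecessor-unique : ∀ a {b} → b ↝ a → predecessor (label b) (proj₁ b) a ≡ b
  predecessor-unique _ {v , j , t} refl = cong (λ j → v , j , t) (back-step t j)

  -- The summands stand for the vertex and its mate, the 2k vertices it points to, and its 2k
  -- predecessors.
  Near : Set
  Near = Fin 2 ⊎ (Fin 2 × Fin k ⊎ Fin 2 × Fin k)

  near : Vertex → Near → Vertex
  near (u , i , s) (inj₁ t)              = u , i , t
  near (u , i , s) (inj₂ (inj₁ (t , v))) = v , step s i , t
  near a           (inj₂ (inj₂ (t , v))) = predecessor t v a

  -- Vertices from different summands lie in different groups, as the absence of loops and 2-cycles
  -- shows. Within a summand, label and index determine the position.
  near-injective : ∀ a → Injective _≡_ _≡_ (near a)
  near-injective a {inj₁ _} {inj₁ _} refl = refl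
  near-injective a {inj₁ _} {inj₂ (inj₁ _)} eq = contradiction (sym (cong group eq)) (no-loop (label a) (group a))
  near-injective a {inj₁ _} {inj₂ (inj₂ (t , v))} eq = contradiction (sym (cong group eq)) (back≢ t (group a))
  near-injective a {inj₂ (inj₁ _)} {inj₁ _} eq = contradiction (cong group eq) (no-loop (label a) (group a))
  near-injective a {inj₂ (inj₁ _)} {inj₂ (inj₁ _)} refl = refl
  near-injective a {inj₂ (inj₁ _)} {inj₂ (inj₂ (t , v))} eq =
    contradiction (cong group eq) (step≢back (label a) t (group a))
  near-injective a {inj₂ (inj₂ (t , v))} {inj₁ _} eq = contradiction (cong group eq) (back≢ t (group a))
  near-injective a {inj₂ (inj₂ (t , v))} {inj₂ (inj₁ _)} eq =
    contradiction (sym (cong group eq)) (step≢back (label a) t (group a))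
  near-injective a {inj₂ (inj₂ _)} {inj₂ (inj₂ _)} eq =
    cong₂ (λ t v → inj₂ (inj₂ (t , v))) (cong label eq) (cong proj₁ eq)

  near-sound : ∀ a j → a ≡ near a j ⊎ Adjacent a (near a j)
  near-sound (u , i , s) (inj₁ t) with ≡⊎opposite s t
  ... | inj₁ refl = inj₁ refl
  ... | inj₂ refl = inj₂ (mates refl)
  near-sound a (inj₂ (inj₁ _))       = inj₂ (out refl)
  near-sound a (inj₂ (inj₂ (t , v))) = inj₂ (into (predecessor-↝ t v a))

  near-complete : ∀ a {b} → a ≡ b ⊎ Adjacent a b → ∃[ j ] near a j ≡ b
  near-complete a (inj₁ refl)                       = inj₁ (label a) , refl
  near-complete a (inj₂ (mates refl))               = inj₁ (opposite (label a)) , refl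
  near-complete a {v , _ , t} (inj₂ (out refl))     = inj₂ (inj₁ (t , v)) , refl
  near-complete a {v , _ , t} (inj₂ (into ba))      = inj₂ (inj₂ (t , v)) , predecessor-unique a ba

  -- The first summand holds the k mate pairs in the group that the vertex points to, the second the
  -- edges from its mate to their 2k common predecessors. Links of the second kind share their
  -- source, so the sinks must tell links apart.
  Link : Set
  Link = Fin k ⊎ Fin 2 × Fin k

  source sink : Vertex → Link → Vertex
  source (u , i , s) (inj₁ v)       = v , step s i , zero
  source a           (inj₂ _)       = mate a
  sink   (u , i , s) (inj₁ v)       = v , step s i , suc zero
  sink   a           (inj₂ (t , v)) = predecessor t v a

  adjacent-source : ∀ a l → Adjacent a (source a l)
  adjacent-source a (inj₁ _) = out refl
  adjacent-source a (inj₂ _) = mates refl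

  adjacent-sink : ∀ a l → Adjacent a (sink a l)
  adjacent-sink a (inj₁ _)       = out refl
  adjacent-sink a (inj₂ (t , v)) = into (predecessor-↝ t v a)

  source-adjacent-sink : ∀ a l → Adjacent (source a l) (sink a l)
  source-adjacent-sink a (inj₁ _)       = mates refl
  source-adjacent-sink a (inj₂ (t , v)) = into (predecessor-↝ t v a)

  sink-injective : ∀ a → Injective _≡_ _≡_ (sink a)
  sink-injective a {inj₁ _} {inj₁ _} refl = refl
  sink-injective a {inj₁ _} {inj₂ (t , v)} eq =
    contradiction (cong group eq) (step≢back (label a) t (group a))
  sink-injective a {inj₂ (t , v)} {inj₁ _} eq =
    contradiction (sym (cong group eq)) (step≢back (label a) t (group a))
  sink-injective a {inj₂ _} {inj₂ _} eq = cong₂ (λ t v → inj₂ (t , v)) (cong label eq) (cong proj₁ eq)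

  -- For two mate pairs the labels differ; in all other cases the groups do.
  sink≢source : ∀ a l l′ → sink a l ≢ source a l′
  sink≢source a (inj₁ _) (inj₁ _) ()
  sink≢source a (inj₁ _) (inj₂ _) eq = no-loop (label a) (group a) (cong group eq)
  sink≢source a (inj₂ (t , v)) (inj₁ _) eq =
    step≢back (label a) t (group a) (sym (cong group eq))
  sink≢source a (inj₂ (t , v)) (inj₂ _) eq =
    back≢ t (group a) (cong group eq)

  EndsOfLink : Vertex → Vertex → Vertex → Set
  EndsOfLink a b c = ∃[ l ] ((source a l ≡ b × sink a l ≡ c) ⊎ (source a l ≡ c × sink a l ≡ b))

  apex-link : ∀ {a} b → a ↝ b → EndsOfLink a b (mate b)
  -- The source of a mate pair is by convention the vertex labelled `zero`, so the label of `b`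
  -- fixes the direction.
  apex-link (v , _ , zero)     refl = inj₁ v , inj₁ (refl , refl)
  apex-link (v , _ , suc zero) refl = inj₁ v , inj₂ (refl , refl)

  triangle-link : ∀ {a b c} → Triangle a b c → EndsOfLink a b c
  triangle-link (apex ab refl) = apex-link _ ab
  triangle-link {a} {c = v , _ , t} (base refl ca)  = inj₂ (t , v) , inj₁ (refl , predecessor-unique a ca)
  triangle-link {a} {b = v , _ , t} (base′ refl ba) = inj₂ (t , v) , inj₂ (refl , predecessor-unique a ba)

  -- Transport to the ground set.

  from-injective : Injective _≡_ _≡_ from
  from-injective {a} {b} eq = trans (sym (strictlyInverseˡ a)) (trans (cong to eq) (strictlyInverseˡ b))

  adjacent-to-from : ∀ {a b} → Adjacent a b → Adjacent a (to (from b))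
  adjacent-to-from {a} = subst (Adjacent a) (sym (strictlyInverseˡ _))

  graph : Graph (k * (m * 2))
  graph = record
    { _~_       = λ x y → Adjacent (to x) (to y)
    ; _~?_      = λ x y → adjacent? (to x) (to y)
    ; ~-sym     = adjacent-sym
    ; ~⇒≢       = λ xy x≡y → adjacent⇒≢ xy (cong to x≡y)
    ; neighbour = λ x → from (mate (to x)) , adjacent-to-from (mates refl)
    ; apex      = λ xy → let c , ac , bc = common-neighbour xy
                         in from c , adjacent-to-from ac , adjacent-to-from bc
    }

  surroundings : ∀ x → Surroundings graph x (2 + (2 * k + 2 * k)) (k + 2 * k)
  surroundings x = record
    { K              = Near
    ; K-size         = (↔-id _ ⊎-↔ ((*↔× ⊎-↔ *↔×) ↔-∘ +↔⊎)) ↔-∘ +↔⊎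
    ; near           = from ∘ near (to x)
    ; near-injective = near-injective (to x) ∘ from-injective
    ; near-sound     = λ j → [ (λ eq → inj₁ (to⇒from eq)) , inj₂ ∘ adjacent-to-from ]′ (near-sound (to x) j)
    ; near-complete  = λ xy →
        let j , eq = near-complete (to x) ([ inj₁ ∘ cong to , inj₂ ]′ xy) in j , sym (to⇒from (sym eq))
    ; L              = Link
    ; L-size         = (↔-id _ ⊎-↔ *↔×) ↔-∘ +↔⊎
    ; source         = from ∘ source (to x)
    ; sink           = from ∘ sink (to x)
    ; x~source       = adjacent-to-from ∘ adjacent-source (to x)
    ; x~sink         = adjacent-to-from ∘ adjacent-sink (to x)
    -- Only the second endpoint can be moved along `from`, so the edge is flipped to move the first
    -- and flipped back.
    ; source~sink    = λ l → adjacent-sym (adjacent-to-from (adjacent-sym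
                         (adjacent-to-from (source-adjacent-sink (to x) l))))
    ; sink-injective = sink-injective (to x) ∘ from-injective
    ; sink≢source    = λ l l′ → sink≢source (to x) l l′ ∘ from-injective
    ; L-complete     = λ xy xz yz →
        let l , eqs = triangle-link (classify xy xz yz)
        in l , [ (λ (p , q) → inj₁ (sym (to⇒from (sym p)) , sym (to⇒from (sym q))))
               , (λ (p , q) → inj₂ (sym (to⇒from (sym p)) , sym (to⇒from (sym q)))) ]′ eqs
    }
    where
    to⇒from : ∀ {y a} → to y ≡ a → y ≡ from a
    to⇒from {y} refl = sym (strictlyInverseʳ y)

-- Arithmetic of the replication number and conclusion.

blow-up-count : ∀ d j →
  (suc j * (6 + d)) ∸ (2 + (2 * suc j + 2 * suc j)) + (suc j + 2 * suc j) ≡ (5 + d) * suc j ∸ 2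
-- Here `6 + d` is twice the number of groups and `suc j` is k. As k is positive, n - (2 + 4k) is
-- the natural number `d + j * (2 + d)`, and truncation loses nothing.
blow-up-count d j = trans
  (cong (_+ (suc j + 2 * suc j))
    (trans (cong (_∸ (2 + (2 * suc j + 2 * suc j))) (total d j))
           (m+n∸m≡n (2 + (2 * suc j + 2 * suc j)) (d + j * (2 + d)))))
  (trans (rest d j) (sym (cong (_∸ 2) (replication d j))))
  where
  total : ∀ d j → suc j * (6 + d) ≡ (2 + (2 * suc j + 2 * suc j)) + (d + j * (2 + d))
  total = solve-∀
  rest : ∀ d j → d + j * (2 + d) + (suc j + 2 * suc j) ≡ 3 + d + j * (5 + d)
  rest = solve-∀
  replication : ∀ d j → (5 + d) * suc j ≡ 2 + (3 + d + j * (5 + d))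
  replication = solve-∀

RegularAntichain : ℕ → ℕ → Set
RegularAntichain n r = Σ (Family n) (λ 𝒜 → IsMaximal23Antichain 𝒜 × Regular r 𝒜)

blow-up : ∀ {m} → Orientation (suc m) → ∀ j → let k = suc j ; n = k * (suc m * 2) in
          RegularAntichain n (n ∸ (2 + (2 * k + 2 * k)) + (k + 2 * k))
blow-up O j =
  Graph.family graph , Graph.isMaximal23Antichain graph zero ,
  λ x → Surroundings.count-through (surroundings x)
  where open BlowUp O (suc j)

theorem7 : (∀ (n : ℕ) → 0 < n → 14 ∣ n →
    Σ (Family n) (λ 𝒜 → IsMaximal23Antichain 𝒜 × Regular ((13 * n) / 14 ∸ 2) 𝒜))
    ×
    (∀ (n : ℕ) → 0 < n → 16 ∣ n →
    Σ (Family n) (λ 𝒜 → IsMaximal23Antichain 𝒜 × Regular ((15 * n) / 16 ∸ 2) 𝒜))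
theorem7 =
  -- A quotient of zero contradicts `0<n`, and the quotient serves as k. The argument 8 of
  -- `blow-up-count` is 14 - 6; for 16 it is 10.
  (λ { n 0<n (divides (suc j) refl) →
       subst (RegularAntichain (suc j * 14)) (replicated 13 14 (suc j) (blow-up-count 8 j))
             (blow-up circulant₇ j) }) ,
  (λ { n 0<n (divides (suc j) refl) →
       subst (RegularAntichain (suc j * 16)) (replicated 15 16 (suc j) (blow-up-count 10 j))
             (blow-up circulant₈ j) })
  where
  -- The division is exact, since `b` divides the ground set size `k * b`.
  replicated : ∀ a b .{{_ : NonZero b}} k {r} → r ≡ a * k ∸ 2 → r ≡ (a * (k * b)) / b ∸ 2
  replicated a b k eq = trans eq (cong (_∸ 2)
    (sym (trans (cong (_/ b) (sym (*-assoc a k b))) (m*n/n≡m (a * k) b))))
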